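{- If a formula $A$ is valid in $\mathbf{IK}$ (i.e. forced at every world of every bi-relational model), then the set-based sequent $\Rightarrow A$ is provable in the calculus $\mathbf{CC}_{\mathbf{IK}}$.
   Context: Formulas are generated by $A ::= p \mid \bot \mid \top \mid (A\wedge A)\mid (A\vee A)\mid (A\supset A)\mid \Box A\mid \Diamond A$, $p$ atomic. A bi-relational model is $\mathcal M=(W,\le,R,V)$ with $W\neq\emptyset$, $\le$ a preorder, $R\subseteq W\times W$, $V:W\to\wp(\mathrm{At})$ with $x\le y\Rightarrow V(x)\subseteq V(y)$, satisfying (FC): if $x\le x'$ and $xRz$ then some $z'$ has $x'Rz'$ and $z\le z'$; (BC): if $xRz$ and $z\le z'$ then some $x'$ has $x\le x'$ and $x'Rz'$. Forcing: $w\not\Vdash\bot$, $w\Vdash\top$, $w\Vdash p$ iff $p\in V(w)$, $\wedge,\vee$ pointwise; $w\Vdash B\supset C$ iff every $w'\ge w$ forcing $B$ forces $C$; $w\Vdash\Box B$ iff $v'\Vdash B$ whenever $w\le w'$ and $w'Rv'$; $w\Vdash\Diamond B$ iff some $v$ with $wRv$ forces $B$. Set-based bi-nested sequents: $\Rightarrow$ is one; if $\Gamma,\Delta'$ are finite sets of formulas and $S_i,T_j$ set-based bi-nested sequents, then $\Gamma\Rightarrow\Delta',\langle S_1\rangle,\dots,\langle S_m\rangle,[T_1],\dots,[T_n]$ is one (consequent a set of formulas and blocks; $\langle\cdot\rangle$ implication blocks, $[\cdot]$ modal blocks). Contexts: $\{\ \}$ is a context; if $\Gamma\Rightarrow\Delta$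 is a sequent and $G'\{\ \}$ a context then $\Gamma\Rightarrow\Delta,\langle G'\{\ \}\rangle$ and $\Gamma\Rightarrow\Delta,[G'\{\ \}]$ are contexts; $G\{S\}$ is the result of filling the hole with $S$. Commas denote set union. Local positive part: if $\Delta=\Delta_0,[\Lambda_1\Rightarrow\Theta_1],\dots,[\Lambda_k\Rightarrow\Theta_k]$ with $\Delta_0$ free of modal blocks, $\Delta^*=[\Lambda_1\Rightarrow\Theta_1^*],\dots,[\Lambda_k\Rightarrow\Theta_k^*]$. Rules of $\mathbf{CC}_{\mathbf{IK}}$ (premises / conclusion; principal formulas are kept in premises): axioms $G\{\Gamma,\bot\Rightarrow\Delta\}$, $G\{\Gamma\Rightarrow\top,\Delta\}$, $G\{\Gamma,p\Rightarrow\Delta,p\}$; $(\wedge_L)$ $G\{A,B,A\wedge B,\Gamma\Rightarrow\Delta\}$ / $G\{A\wedge B,\Gamma\Rightarrow\Delta\}$; $(\wedge_R)$ $G\{\Gamma\Rightarrow\Delta,A\wedge B,A\}$ and $G\{\Gamma\Rightarrow\Delta,A\wedge B,B\}$ / $G\{\Gamma\Rightarrow\Delta,A\wedge B\}$; $(\vee_L)$ $G\{\Gamma,A,A\vee B\Rightarrow\Delta\}$ and $G\{\Gamma,B,A\vee B\Rightarrow\Delta\}$ / $G\{\Gamma,A\vee B\Rightarrow\Delta\}$; $(\vee_R)$ $G\{\Gamma\Rightarrow\Delta,A\vee B,A,B\}$ / $G\{\Gamma\Rightarrow\Delta,A\vee B\}$; $(\supset_L)$ $G\{\Gamma,A\supset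 B\Rightarrow A,\Delta\}$ and $G\{\Gamma,A\supset B,B\Rightarrow\Delta\}$ / $G\{\Gamma,A\supset B\Rightarrow\Delta\}$; $(\supset_R)$, if $A\in\Gamma$: $G\{\Gamma\Rightarrow\Delta,A\supset B,B\}$ / $G\{\Gamma\Rightarrow\Delta,A\supset B\}$; if $A\notin\Gamma$: $G\{\Gamma\Rightarrow\Delta,A\supset B,\langle A\Rightarrow B\rangle\}$ / $G\{\Gamma\Rightarrow\Delta,A\supset B\}$; $(\Box_L)$ $G\{\Gamma,\Box A\Rightarrow\Delta,[\Sigma,A\Rightarrow\Pi]\}$ / $G\{\Gamma,\Box A\Rightarrow\Delta,[\Sigma\Rightarrow\Pi]\}$; $(\Box_R)$ $G\{\Gamma\Rightarrow\Delta,\Box A,\langle\ \Rightarrow[\ \Rightarrow A]\rangle\}$ / $G\{\Gamma\Rightarrow\Delta,\Box A\}$; $(\Diamond_L)$ $G\{\Gamma,\Diamond A\Rightarrow\Delta,[A\Rightarrow\ ]\}$ / $G\{\Gamma,\Diamond A\Rightarrow\Delta\}$; $(\Diamond_R)$ $G\{\Gamma\Rightarrow\Delta,\Diamond A,[\Sigma\Rightarrow\Pi,A]\}$ / $G\{\Gamma\Rightarrow\Delta,\Diamond A,[\Sigma\Rightarrow\Pi]\}$; (trans) $G\{\Gamma,\Gamma'\Rightarrow\Delta,\langle\Gamma',\Sigma\Rightarrow\Pi\rangle\}$ / $G\{\Gamma,\Gamma'\Rightarrow\Delta,\langle\Sigma\Rightarrow\Pi\rangle\}$; $(\mathrm{inter}_{fc})$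 $G\{\Gamma\Rightarrow\Delta,\langle\Sigma\Rightarrow\Pi,[\Lambda\Rightarrow\Theta^*]\rangle,[\Lambda\Rightarrow\Theta]\}$ / $G\{\Gamma\Rightarrow\Delta,\langle\Sigma\Rightarrow\Pi\rangle,[\Lambda\Rightarrow\Theta]\}$; $(\mathrm{inter}_{bc})$ $G\{\Gamma\Rightarrow\Delta,[\Lambda\Rightarrow\Theta,\langle\Sigma\Rightarrow\Pi\rangle],\langle\ \Rightarrow[\Sigma\Rightarrow\Pi]\rangle\}$ / $G\{\Gamma\Rightarrow\Delta,[\Lambda\Rightarrow\Theta,\langle\Sigma\Rightarrow\Pi\rangle]\}$. A proof of $S$ is a finite tree of sequents built with these rules, rooted at $S$, whose leaves are axioms. -}

module Defs where

open import Data.Nat using (ℕ)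
open import Data.List using (List; []; _∷_; [_]; _++_)
open import Data.List.Membership.Propositional using (_∈_)
open import Data.List.Relation.Binary.Subset.Propositional using (_⊆_)
open import Data.Product using (Σ; _×_)
open import Data.Sum using (_⊎_)
open import Data.Empty using (⊥)
open import Data.Unit using (⊤)
open import Relation.Nullary using (¬_)

infixr 6 _∧_
infixr 5 _∨_
infixr 4 _⊃_

data Fm : Set where
  atom : ℕ → Fm
  ⊥'   : Fm
  ⊤'   : Fm
  _∧_  : Fm → Fm → Fm
  _∨_  : Fm → Fm → Fm
  _⊃_  : Fm → Fm → Fm
  □    : Fm → Fm
  ◇    : Fm → Fm

record Model : Set₁ where
  field
    W       : Set
    _≤_     : W → W → Set
    ≤-refl  : ∀ {x} → x ≤ x
    ≤-trans : ∀ {x y z} → x ≤ y → y ≤ z → x ≤ z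
    R       : W → W → Set
    V       : W → ℕ → Set
    V-mono  : ∀ {x y p} → x ≤ y → V x p → V y p
    FC      : ∀ {x x' z} → x ≤ x' → R x z → Σ W (λ z' → R x' z' × z ≤ z')
    BC      : ∀ {x z z'} → R x z → z ≤ z' → Σ W (λ x' → x ≤ x' × R x' z')

module _ (M : Model) where
  open Model M

  _⊩_ : W → Fm → Set
  w ⊩ atom p = V w p
  w ⊩ ⊥'     = ⊥
  w ⊩ ⊤'     = ⊤
  w ⊩ (A ∧ B) = (w ⊩ A) × (w ⊩ B)
  w ⊩ (A ∨ B) = (w ⊩ A) ⊎ (w ⊩ B)
  w ⊩ (A ⊃ B) = ∀ w' → w ≤ w' → w' ⊩ A → w' ⊩ B
  w ⊩ □ A     = ∀ w' v' → w ≤ w' → R w' v' → v' ⊩ A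
  w ⊩ ◇ A     = Σ W (λ v → R w v × v ⊩ A)

Valid : Fm → Set₁
Valid A = ∀ (M : Model) (w : Model.W M) → _⊩_ M w A

-- Bi-nested sequents.  Finite sets are represented by lists; the
-- set-based reading is recovered by the hereditary extensional
-- equivalence _≈S_ below, under which provability is closed.

infix 3 _⇒_

mutual
  data Seq : Set where
    _⇒_ : List Fm → List Item → Seq

  data Item : Set where
    fm  : Fm → Item
    imp : Seq → Item
    box : Seq → Item

mutual
  data _≈S_ : Seq → Seq → Set where
    seq≈ : ∀ {Γ Γ' Δ Δ'} → Γ ⊆ Γ' → Γ' ⊆ Γ → Δ ⊑ Δ' → Δ' ⊑ Δ →
           (Γ ⇒ Δ) ≈S (Γ' ⇒ Δ')

  data _≈I_ : Item → Item → Set where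
    fm≈  : ∀ {A} → fm A ≈I fm A
    imp≈ : ∀ {S S'} → S ≈S S' → imp S ≈I imp S'
    box≈ : ∀ {S S'} → S ≈S S' → box S ≈I box S'

  data _∈≈_ : Item → List Item → Set where
    here  : ∀ {x y ys} → x ≈I y → x ∈≈ (y ∷ ys)
    there : ∀ {x y ys} → x ∈≈ ys → x ∈≈ (y ∷ ys)

  data _⊑_ : List Item → List Item → Set where
    []⊑ : ∀ {ys} → [] ⊑ ys
    ∷⊑  : ∀ {x xs ys} → x ∈≈ ys → xs ⊑ ys → (x ∷ xs) ⊑ ys

star : List Item → List Item
star []                  = []
star (fm _ ∷ xs)         = star xs
star (imp _ ∷ xs)        = star xs
star (box (Λ ⇒ Θ) ∷ xs)  = box (Λ ⇒ star Θ) ∷ star xs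

data Ctx : Set where
  hole : Ctx
  inI  : List Fm → List Item → Ctx → Ctx
  inB  : List Fm → List Item → Ctx → Ctx

_⟦_⟧ : Ctx → Seq → Seq
hole        ⟦ S ⟧ = S
inI Γ Δ G   ⟦ S ⟧ = Γ ⇒ imp (G ⟦ S ⟧) ∷ Δ
inB Γ Δ G   ⟦ S ⟧ = Γ ⇒ box (G ⟦ S ⟧) ∷ Δ

data Prov : Seq → Set where
  -- set-based reading: sequents equal as (hereditary) sets are identified
  set≈ : ∀ {S S'} → S ≈S S' → Prov S' → Prov S

  ax⊥ : ∀ G {Γ Δ} → Prov (G ⟦ ⊥' ∷ Γ ⇒ Δ ⟧)
  ax⊤ : ∀ G {Γ Δ} → Prov (G ⟦ Γ ⇒ fm ⊤' ∷ Δ ⟧)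
  axp : ∀ G {p Γ Δ} → Prov (G ⟦ atom p ∷ Γ ⇒ fm (atom p) ∷ Δ ⟧)

  ∧L : ∀ G {A B Γ Δ} →
       Prov (G ⟦ A ∷ B ∷ (A ∧ B) ∷ Γ ⇒ Δ ⟧) →
       Prov (G ⟦ (A ∧ B) ∷ Γ ⇒ Δ ⟧)
  ∧R : ∀ G {A B Γ Δ} →
       Prov (G ⟦ Γ ⇒ fm (A ∧ B) ∷ fm A ∷ Δ ⟧) →
       Prov (G ⟦ Γ ⇒ fm (A ∧ B) ∷ fm B ∷ Δ ⟧) →
       Prov (G ⟦ Γ ⇒ fm (A ∧ B) ∷ Δ ⟧)
  ∨L : ∀ G {A B Γ Δ} →
       Prov (G ⟦ A ∷ (A ∨ B) ∷ Γ ⇒ Δ ⟧) →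
       Prov (G ⟦ B ∷ (A ∨ B) ∷ Γ ⇒ Δ ⟧) →
       Prov (G ⟦ (A ∨ B) ∷ Γ ⇒ Δ ⟧)
  ∨R : ∀ G {A B Γ Δ} →
       Prov (G ⟦ Γ ⇒ fm (A ∨ B) ∷ fm A ∷ fm B ∷ Δ ⟧) →
       Prov (G ⟦ Γ ⇒ fm (A ∨ B) ∷ Δ ⟧)
  ⊃L : ∀ G {A B Γ Δ} →
       Prov (G ⟦ (A ⊃ B) ∷ Γ ⇒ fm A ∷ Δ ⟧) →
       Prov (G ⟦ B ∷ (A ⊃ B) ∷ Γ ⇒ Δ ⟧) →
       Prov (G ⟦ (A ⊃ B) ∷ Γ ⇒ Δ ⟧)
  ⊃R₁ : ∀ G {A B Γ Δ} → A ∈ Γ →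
       Prov (G ⟦ Γ ⇒ fm (A ⊃ B) ∷ fm B ∷ Δ ⟧) →
       Prov (G ⟦ Γ ⇒ fm (A ⊃ B) ∷ Δ ⟧)
  ⊃R₂ : ∀ G {A B Γ Δ} → ¬ (A ∈ Γ) →
       Prov (G ⟦ Γ ⇒ fm (A ⊃ B) ∷ imp ([ A ] ⇒ [ fm B ]) ∷ Δ ⟧) →
       Prov (G ⟦ Γ ⇒ fm (A ⊃ B) ∷ Δ ⟧)
  □L : ∀ G {A Γ Δ Σ' Π} →
       Prov (G ⟦ □ A ∷ Γ ⇒ box (A ∷ Σ' ⇒ Π) ∷ Δ ⟧) →
       Prov (G ⟦ □ A ∷ Γ ⇒ box (Σ' ⇒ Π) ∷ Δ ⟧)
  □R : ∀ G {A Γ Δ} →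
       Prov (G ⟦ Γ ⇒ fm (□ A) ∷ imp ([] ⇒ [ box ([] ⇒ [ fm A ]) ]) ∷ Δ ⟧) →
       Prov (G ⟦ Γ ⇒ fm (□ A) ∷ Δ ⟧)
  ◇L : ∀ G {A Γ Δ} →
       Prov (G ⟦ ◇ A ∷ Γ ⇒ box ([ A ] ⇒ []) ∷ Δ ⟧) →
       Prov (G ⟦ ◇ A ∷ Γ ⇒ Δ ⟧)
  ◇R : ∀ G {A Γ Δ Σ' Π} →
       Prov (G ⟦ Γ ⇒ fm (◇ A) ∷ box (Σ' ⇒ fm A ∷ Π) ∷ Δ ⟧) →
       Prov (G ⟦ Γ ⇒ fm (◇ A) ∷ box (Σ' ⇒ Π) ∷ Δ ⟧)
  trans : ∀ G {Γ Γ' Δ Σ' Π} →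
       Prov (G ⟦ Γ ++ Γ' ⇒ imp (Γ' ++ Σ' ⇒ Π) ∷ Δ ⟧) →
       Prov (G ⟦ Γ ++ Γ' ⇒ imp (Σ' ⇒ Π) ∷ Δ ⟧)
  inter-fc : ∀ G {Γ Δ Σ' Π Λ Θ} →
       Prov (G ⟦ Γ ⇒ imp (Σ' ⇒ box (Λ ⇒ star Θ) ∷ Π) ∷ box (Λ ⇒ Θ) ∷ Δ ⟧) →
       Prov (G ⟦ Γ ⇒ imp (Σ' ⇒ Π) ∷ box (Λ ⇒ Θ) ∷ Δ ⟧)
  inter-bc : ∀ G {Γ Δ Σ' Π Λ Θ} →
       Prov (G ⟦ Γ ⇒ box (Λ ⇒ imp (Σ' ⇒ Π) ∷ Θ) ∷ imp ([] ⇒ [ box (Σ' ⇒ Π) ]) ∷ Δ ⟧) →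
       Prov (G ⟦ Γ ⇒ box (Λ ⇒ imp (Σ' ⇒ Π) ∷ Θ) ∷ Δ ⟧)

{-# OPTIONS --safe #-}
-- A sequent without implication blocks is a finite tree of signed formulas, and over the
-- subformulas of A, with modal degree bounding the depth, there are finitely many such trees
-- up to set equality.  The logical rules other than ⊃R and □R never pass information from a
-- block to its parent, so one top-down pass covers any tree by saturated trees from this
-- finite list.
-- From the list one discards, as long as possible, a tree having a node with A ⊃ B or □ A on
-- the right for which no remaining saturated tree lies above and refutes it.  A discarded tree
-- is provable: after ⊃R or □R, the rules trans, inter-fc and inter-bc carry the new implication
-- block up to the root, where it contains the whole positive part of the tree, and this is
-- covered by trees already discarded.  The nodes of the remaining saturated trees, seen as paths
-- from the root, ordered by pointwise simulation and with R extending a path by one step, form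
-- a countermodel, in which (FC) and (BC) hold by construction.

module Submission where

open import Defs
open import Data.Nat using (ℕ; zero; suc; s≤s; _⊔_)
import Data.Nat as ℕ
import Data.Nat.Properties as ℕ
open import Data.List
  using (List; []; _∷_; [_]; _++_; map; concatMap; filter; length; cartesianProductWith)
open import Data.List.Membership.Propositional using (_∈_; find; lose)
open import Data.List.Membership.Propositional.Properties
open import Data.List.Relation.Binary.Subset.Propositional using (_⊆_)
open import Data.List.Relation.Binary.Subset.Propositional.Properties using (∷⁺ʳ; concatMap⁺)
open import Data.List.Relation.Unary.All as All using (All; []; _∷_)
import Data.List.Relation.Unary.All.Properties as All
open import Data.List.Relation.Unary.Any as Any using (Any; here; there)
open import Data.Product using (Σ; ∃; _×_; _,_; proj₁; proj₂)
open import Data.Sum using (_⊎_; inj₁; inj₂; [_,_]′; map₁; map₂) renaming (map to ⊎-map)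
open import Data.Empty using (⊥; ⊥-elim)
open import Data.Unit using (⊤; tt)
open import Function using (id; _∘_)
open import Relation.Nullary using (Dec; yes; no; ¬_)
open import Relation.Nullary.Decidable using (map′; _×-dec_)
open import Relation.Binary.PropositionalEquality using (_≡_; refl; sym; cong; subst)
  renaming (trans to ≡-trans)

-- Decidable equality of formulas.

tag : Fm → ℕ
tag (atom _) = 0
tag ⊥'       = 1
tag ⊤'       = 2
tag (_ ∧ _)  = 3
tag (_ ∨ _)  = 4
tag (_ ⊃ _)  = 5
tag (□ _)    = 6
tag (◇ _)    = 7

infix 4 _≟_

mutual
  _≟_ : (A B : Fm) → Dec (A ≡ B)
  A ≟ B with tag A ℕ.≟ tag B
  ... | yes e = sameTag A B e
  ... | no ne = no (ne ∘ cong tag)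

  -- Equal tags leave only the eight diagonal cases.
  sameTag : (A B : Fm) → tag A ≡ tag B → Dec (A ≡ B)
  sameTag (atom p) (atom q) refl = map′ (cong atom) (λ { refl → refl }) (p ℕ.≟ q)
  sameTag ⊥' ⊥' refl = yes refl
  sameTag ⊤' ⊤' refl = yes refl
  sameTag (A ∧ B) (C ∧ D) refl =
    map′ (λ { (refl , refl) → refl }) (λ { refl → refl , refl }) ((A ≟ C) ×-dec (B ≟ D))
  sameTag (A ∨ B) (C ∨ D) refl =
    map′ (λ { (refl , refl) → refl }) (λ { refl → refl , refl }) ((A ≟ C) ×-dec (B ≟ D))
  sameTag (A ⊃ B) (C ⊃ D) refl =
    map′ (λ { (refl , refl) → refl }) (λ { refl → refl , refl }) ((A ≟ C) ×-dec (B ≟ D))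
  sameTag (□ A) (□ B) refl = map′ (cong □) (λ { refl → refl }) (A ≟ B)
  sameTag (◇ A) (◇ B) refl = map′ (cong ◇) (λ { refl → refl }) (A ≟ B)

-- Structural rules of the set-based reading

mutual
  ≈S-refl : ∀ S → S ≈S S
  ≈S-refl (Γ ⇒ Δ) = seq≈ id id (⊆⇒⊑ (≈I-refls Δ) id) (⊆⇒⊑ (≈I-refls Δ) id)

  ≈I-refl : ∀ x → x ≈I x
  ≈I-refl (fm A)  = fm≈
  ≈I-refl (imp S) = imp≈ (≈S-refl S)
  ≈I-refl (box S) = box≈ (≈S-refl S)

  ≈I-refls : ∀ Δ → All (λ x → x ≈I x) Δ
  ≈I-refls []      = []
  ≈I-refls (x ∷ Δ) = ≈I-refl x ∷ ≈I-refls Δ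

  ∈⇒∈≈ : ∀ {x ys} → x ≈I x → x ∈ ys → x ∈≈ ys
  ∈⇒∈≈ r (here refl) = here r
  ∈⇒∈≈ r (there i)   = there (∈⇒∈≈ r i)

  ⊆⇒⊑ : ∀ {xs ys} → All (λ x → x ≈I x) xs → xs ⊆ ys → xs ⊑ ys
  ⊆⇒⊑ []       f = []⊑
  ⊆⇒⊑ (r ∷ rs) f = ∷⊑ (∈⇒∈≈ r (f (here refl))) (⊆⇒⊑ rs (f ∘ there))

≈S-sym : ∀ {S S'} → S ≈S S' → S' ≈S S
≈S-sym (seq≈ a b c d) = seq≈ b a d c

∷-cong : ∀ {x y} Δ → x ≈I y → (x ∷ Δ) ⊑ (y ∷ Δ)
∷-cong Δ e = ∷⊑ (here e) (⊆⇒⊑ (≈I-refls Δ) there)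

⟦⟧-cong : ∀ G {S S'} → S ≈S S' → (G ⟦ S ⟧) ≈S (G ⟦ S' ⟧)
⟦⟧-cong hole        e = e
⟦⟧-cong (inI Γ Δ G) e =
  seq≈ id id (∷-cong Δ (imp≈ (⟦⟧-cong G e))) (∷-cong Δ (imp≈ (≈S-sym (⟦⟧-cong G e))))
⟦⟧-cong (inB Γ Δ G) e =
  seq≈ id id (∷-cong Δ (box≈ (⟦⟧-cong G e))) (∷-cong Δ (box≈ (≈S-sym (⟦⟧-cong G e))))

resp : ∀ G {Γ Γ' Δ Δ'} → Γ ⊆ Γ' → Γ' ⊆ Γ → Δ ⊆ Δ' → Δ' ⊆ Δ →
       Prov (G ⟦ Γ' ⇒ Δ' ⟧) → Prov (G ⟦ Γ ⇒ Δ ⟧)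
resp G {Δ = Δ} {Δ'} a b c d =
  set≈ (⟦⟧-cong G (seq≈ a b (⊆⇒⊑ (≈I-refls Δ) c) (⊆⇒⊑ (≈I-refls Δ') d)))

absorb : ∀ {a} {X : Set a} {x : X} {xs} → x ∈ xs → (x ∷ xs) ⊆ xs
absorb i (here refl) = i
absorb i (there j)   = j

skip₂ : ∀ {a} {X : Set a} {x y : X} {xs} → xs ⊆ (x ∷ y ∷ xs)
skip₂ i = there (there i)

-- Repetition is immaterial for sets, so a rule stated for a formula at the head applies to any
-- member.
contractˡ : ∀ G {A Γ Δ} → A ∈ Γ → Prov (G ⟦ A ∷ Γ ⇒ Δ ⟧) → Prov (G ⟦ Γ ⇒ Δ ⟧)
contractˡ G i = resp G there (absorb i) id id

contractʳ : ∀ G {x Γ Δ} → x ∈ Δ → Prov (G ⟦ Γ ⇒ x ∷ Δ ⟧) → Prov (G ⟦ Γ ⇒ Δ ⟧)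
contractʳ G i = resp G id id there (absorb i)

contractˡʳ : ∀ G {A x Γ Δ} → A ∈ Γ → x ∈ Δ → Prov (G ⟦ A ∷ Γ ⇒ x ∷ Δ ⟧) → Prov (G ⟦ Γ ⇒ Δ ⟧)
contractˡʳ G i j = resp G there (absorb i) there (absorb j)

_∘C_ : Ctx → Ctx → Ctx
hole      ∘C H = H
inI Γ Δ G ∘C H = inI Γ Δ (G ∘C H)
inB Γ Δ G ∘C H = inB Γ Δ (G ∘C H)

∘C-⟦⟧ : ∀ G {H S} → (G ∘C H) ⟦ S ⟧ ≡ G ⟦ H ⟦ S ⟧ ⟧
∘C-⟦⟧ hole        = refl
∘C-⟦⟧ (inI Γ Δ G) = cong (λ S → Γ ⇒ imp S ∷ Δ) (∘C-⟦⟧ G)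
∘C-⟦⟧ (inB Γ Δ G) = cong (λ S → Γ ⇒ box S ∷ Δ) (∘C-⟦⟧ G)

unnest : ∀ G H {S} → Prov ((G ∘C H) ⟦ S ⟧) → Prov (G ⟦ H ⟦ S ⟧ ⟧)
unnest G H = subst Prov (∘C-⟦⟧ G)

nest : ∀ G H {S} → Prov (G ⟦ H ⟦ S ⟧ ⟧) → Prov ((G ∘C H) ⟦ S ⟧)
nest G H = subst Prov (sym (∘C-⟦⟧ G))

-- `Δ'` only steers the recursion: each `inter-fc` keeps its modal block, so all of `Δ` survives.
inter-fcs : ∀ G {Γ Σ' Π Δ} Δ' → Δ' ⊆ Δ →
            Prov (G ⟦ Γ ⇒ imp (Σ' ⇒ star Δ' ++ Π) ∷ Δ ⟧) →
            Prov (G ⟦ Γ ⇒ imp (Σ' ⇒ Π) ∷ Δ ⟧)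
inter-fcs G []                   f d = d
inter-fcs G (fm _ ∷ Δ')          f d = inter-fcs G Δ' (f ∘ there) d
inter-fcs G (imp _ ∷ Δ')         f d = inter-fcs G Δ' (f ∘ there) d
inter-fcs G (box (Λ ⇒ Θ) ∷ Δ') f d = inter-fcs G Δ' (f ∘ there)
  (resp G id id (∷⁺ʳ _ there) (∷⁺ʳ _ (absorb i))
    (inter-fc G (resp G id id (∷⁺ʳ _ (absorb i)) (∷⁺ʳ _ there) d)))
  where i = f (here refl)

saturate-imp : ∀ G {Γ Δ Σ' Π} →
               Prov (G ⟦ Γ ⇒ imp (Γ ++ Σ' ⇒ star Δ ++ Π) ∷ Δ ⟧) →
               Prov (G ⟦ Γ ⇒ imp (Σ' ⇒ Π) ∷ Δ ⟧)
saturate-imp G {Γ} {Δ} d = trans G {[]} {Γ} (inter-fcs G Δ id d)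

-- Signed formulas and trees

data SFm : Set where
  L R : Fm → SFm

data IsL : SFm → Set where
  isL : ∀ {A} → IsL (L A)

isL? : ∀ X → Dec (IsL X)
isL? (L A) = yes isL
isL? (R A) = no λ ()

lefts : List SFm → List SFm
lefts = filter isL?

-- Modal blocks only: implication blocks are recorded by the order between trees.
data Tree : Set where
  node : List SFm → List Tree → Tree

labels : Tree → List SFm
labels (node l cs) = l

kids : Tree → List Tree
kids (node l cs) = cs

mutual
  -- The positive part, corresponding to the passage from `Γ ⇒ Δ` to `Γ ⇒ star Δ`.
  _° : Tree → Tree
  node l cs ° = node (lefts l) (cs °s)

  _°s : List Tree → List Tree
  []       °s = []
  (c ∷ cs) °s = (c °) ∷ (cs °s)

∈-°s⁻ : ∀ {c} cs → c ∈ cs °s → ∃ λ c' → c' ∈ cs × c ≡ c' °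
∈-°s⁻ (c ∷ cs) (here e)  = c , here refl , e
∈-°s⁻ (c ∷ cs) (there i) = let c' , j , e = ∈-°s⁻ cs i in c' , there j , e

∈-°s⁺ : ∀ {c cs} → c ∈ cs → c ° ∈ cs °s
∈-°s⁺ (here refl) = here refl
∈-°s⁺ (there i)   = there (∈-°s⁺ i)

-- What a world above `t` must contain if it is also to contain `y`.
merge : Tree → Tree → Tree
merge (node l cs) (node m ds) = node (m ++ lefts l) (ds ++ cs °s)

-- `P` selects the labels to be preserved: all for containment `_↪_`, the left ones for the order
-- `_⊴_` of the countermodel. The map on children is a separate field, which keeps recursion through
-- the last field structural.
data Sim (P : SFm → Set) : Tree → Tree → Set where
  sim : ∀ {l cs l' cs'} →
        (∀ {X} → X ∈ l → P X → X ∈ l') →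
        (σ : ∀ {c} → c ∈ cs → Tree) →
        (∀ {c} (i : c ∈ cs) → σ i ∈ cs') →
        (∀ {c} (i : c ∈ cs) → Sim P c (σ i)) →
        Sim P (node l cs) (node l' cs')

Always : SFm → Set
Always _ = ⊤

infix 4 _↪_ _⊴_ _≼_ _∈ˢ_

_↪_ _⊴_ : Tree → Tree → Set
_↪_ = Sim Always
_⊴_ = Sim IsL

module _ {P : SFm → Set} where

  sim-labels : ∀ {t t' X} → Sim P t t' → X ∈ labels t → P X → X ∈ labels t'
  sim-labels (sim f _ _ _) = f

  sim-kid : ∀ {t t' c} → Sim P t t' → c ∈ kids t → ∃ λ c' → c' ∈ kids t' × Sim P c c'
  sim-kid (sim _ σ k s) i = σ i , k i , s i

  mk-sim : ∀ {l cs l' cs'} → (∀ {X} → X ∈ l → P X → X ∈ l') →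
           (∀ {c} → c ∈ cs → ∃ λ c' → c' ∈ cs' × Sim P c c') →
           Sim P (node l cs) (node l' cs')
  mk-sim f k = sim f (proj₁ ∘ k) (proj₁ ∘ proj₂ ∘ k) (proj₂ ∘ proj₂ ∘ k)

  mutual
    sim-refl : ∀ t → Sim P t t
    sim-refl (node l cs) = mk-sim (λ i _ → i) (λ i → _ , i , All.lookup (sim-refls cs) i)

    sim-refls : ∀ cs → All (λ c → Sim P c c) cs
    sim-refls []       = []
    sim-refls (c ∷ cs) = sim-refl c ∷ sim-refls cs

  sim-trans : ∀ {t u v} → Sim P t u → Sim P u v → Sim P t v
  sim-trans (sim f σ k s) (sim f' σ' k' s') =
    sim (λ i p → f' (f i p) p) (λ i → σ' (k i)) (λ i → k' (k i))
        (λ i → sim-trans (s i) (s' (k i)))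

  sim-⊆ : ∀ {l l' cs cs'} → l ⊆ l' → cs ⊆ cs' → Sim P (node l cs) (node l' cs')
  sim-⊆ f g = mk-sim (λ i _ → f i) (λ i → _ , g i , sim-refl _)

°↪⇒⊴ : ∀ {t t'} → t ° ↪ t' → t ⊴ t'
°↪⇒⊴ {node l cs} (sim f σ k s) =
  sim (λ { i isL → f (∈-filter⁺ isL? i isL) tt }) (λ i → σ (∈-°s⁺ i)) (λ i → k (∈-°s⁺ i))
      (λ i → °↪⇒⊴ (s (∈-°s⁺ i)))

-- Trees inside sequents.

_∈ˢ_ : SFm → Seq → Set
L A ∈ˢ (Γ ⇒ Δ) = A ∈ Γ
R A ∈ˢ (Γ ⇒ Δ) = fm A ∈ Δ

data _≼_ : Tree → Seq → Set where
  emb : ∀ {l cs Γ Δ} →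
        (∀ {X} → X ∈ l → X ∈ˢ (Γ ⇒ Δ)) →
        (σ : ∀ {c} → c ∈ cs → Seq) →
        (∀ {c} (i : c ∈ cs) → box (σ i) ∈ Δ) →
        (∀ {c} (i : c ∈ cs) → c ≼ σ i) →
        node l cs ≼ (Γ ⇒ Δ)

_⊆ˢ_ : Seq → Seq → Set
(Γ ⇒ Δ) ⊆ˢ (Γ' ⇒ Δ') = Γ ⊆ Γ' × Δ ⊆ Δ'

∈ˢ-⊆ : ∀ {S S'} X → S ⊆ˢ S' → X ∈ˢ S → X ∈ˢ S'
∈ˢ-⊆ {Γ ⇒ Δ} {Γ' ⇒ Δ'} (L A) (f , g) = f
∈ˢ-⊆ {Γ ⇒ Δ} {Γ' ⇒ Δ'} (R A) (f , g) = g

mk-emb : ∀ {l cs Γ Δ} → (∀ {X} → X ∈ l → X ∈ˢ (Γ ⇒ Δ)) →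
         (∀ {c} → c ∈ cs → ∃ λ s → box s ∈ Δ × c ≼ s) → node l cs ≼ (Γ ⇒ Δ)
mk-emb f k = emb f (proj₁ ∘ k) (proj₁ ∘ proj₂ ∘ k) (proj₂ ∘ proj₂ ∘ k)

emb-label : ∀ {t S X} → t ≼ S → X ∈ labels t → X ∈ˢ S
emb-label (emb f _ _ _) = f

emb-kid : ∀ {t Γ Δ c} → t ≼ (Γ ⇒ Δ) → c ∈ kids t → ∃ λ s → box s ∈ Δ × c ≼ s
emb-kid (emb _ σ b e) i = σ i , b i , e i

≼-⊆ : ∀ {t S S'} → S ⊆ˢ S' → t ≼ S → t ≼ S'
≼-⊆ {S' = Γ' ⇒ Δ'} g (emb f σ b e) = emb (λ i → ∈ˢ-⊆ _ g (f i)) σ (λ i → proj₂ g (b i)) e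

↪-≼ : ∀ {t t' S} → t ↪ t' → t' ≼ S → t ≼ S
↪-≼ (sim f σ k s) (emb f' σ' b e) =
  emb (λ i → f' (f i tt)) (λ i → σ' (k i)) (λ i → b (k i)) (λ i → ↪-≼ (s i) (e (k i)))

°↪ : ∀ t → t ° ↪ t
°↪s : ∀ cs → All (λ c → c ° ↪ c) cs
°↪ (node l cs) = mk-sim (λ i _ → proj₁ (∈-filter⁻ isL? i)) kid
  where
  kid : ∀ {c} → c ∈ cs °s → ∃ λ c' → c' ∈ cs × c ↪ c'
  kid i with ∈-°s⁻ cs i
  ... | c' , j , refl = c' , j , All.lookup (°↪s cs) j
°↪s []       = []
°↪s (c ∷ cs) = °↪ c ∷ °↪s cs

starS : Seq → Seq
starS (Λ ⇒ Θ) = Λ ⇒ star Θ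

∈-star : ∀ {s Θ} → box s ∈ Θ → box (starS s) ∈ star Θ
∈-star {s = Λ ⇒ Θ'} {box _ ∷ Θ}  (here refl) = here refl
∈-star {Θ = fm _ ∷ Θ}        (there i)   = ∈-star i
∈-star {Θ = imp _ ∷ Θ}       (there i)   = ∈-star i
∈-star {Θ = box (_ ⇒ _) ∷ Θ} (there i)   = there (∈-star i)

°-≼-star : ∀ {t s} → t ≼ s → t ° ≼ starS s
°-≼-star {node l cs} {Γ ⇒ Δ} (emb f σ b e) = mk-emb left kid
  where
  left : ∀ {X} → X ∈ lefts l → X ∈ˢ (Γ ⇒ star Δ)
  left i with ∈-filter⁻ isL? {xs = l} i
  ... | j , isL = f j
  kid : ∀ {c} → c ∈ cs °s → ∃ λ s → box s ∈ star Δ × c ≼ s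
  kid i with ∈-°s⁻ cs i
  ... | c' , j , refl = starS (σ j) , ∈-star (b j) , °-≼-star (e j)

++-≼ : ∀ {l m cs ds Γ Δ} → node l cs ≼ (Γ ⇒ Δ) → node m ds ≼ (Γ ⇒ Δ) →
       node (l ++ m) (cs ++ ds) ≼ (Γ ⇒ Δ)
++-≼ {l} {m} {cs} {ds} p q =
  mk-emb (λ i → [ emb-label p , emb-label q ]′ (∈-++⁻ l i))
         (λ i → [ emb-kid p , emb-kid q ]′ (∈-++⁻ cs i))

merge-≼ : ∀ {t y Γ Δ} → t ° ≼ (Γ ⇒ Δ) → y ≼ (Γ ⇒ Δ) → merge t y ≼ (Γ ⇒ Δ)
merge-≼ {node l cs} {node m ds} p q = ++-≼ q p

-- The sequent on the right is exactly the block that `saturate-imp` produces.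
merge-≼-imp : ∀ {t y Γ Δ Σ' Π} → t ≼ (Γ ⇒ Δ) → y ≼ (Σ' ⇒ Π) →
              merge t y ≼ (Γ ++ Σ' ⇒ star Δ ++ Π)
merge-≼-imp {Γ = Γ} {Δ} p q =
  merge-≼ (≼-⊆ (∈-++⁺ˡ , ∈-++⁺ˡ) (°-≼-star p)) (≼-⊆ (∈-++⁺ʳ Γ , ∈-++⁺ʳ (star Δ)) q)

-- Strong provability

SPat : Tree → Ctx → Set
SPat t G = ∀ S → t ≼ S → Prov (G ⟦ S ⟧)

-- Quantifying over all sequents above t builds weakening in.  Weakening a given derivation is
-- no option, since the side condition of ⊃R₂ need not survive it.
SP : Tree → Set
SP t = ∀ G → SPat t G

-- Provability in G of a sequent above t that either already refutes y at its own root
-- or has an implication block refuting y.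
record Raised (t y : Tree) (G : Ctx) : Set where
  field
    via-imp : ∀ {Γ Δ Y} → t ≼ (Γ ⇒ Δ) → imp Y ∈ Δ → y ≼ Y → Prov (G ⟦ Γ ⇒ Δ ⟧)
    in-situ : SPat (merge t y) G
open Raised

-- Paths and grafting.

data Path (T : Tree) : Tree → Set where
  []  : Path T T
  _▹_ : ∀ {t c} → Path T t → c ∈ kids t → Path T c

-- The tree forced at an implication successor of T in which y is to be refuted at the end of p.
graft : ∀ {T t} → Path T t → Tree → Tree
graft {T} []      y = merge T y
graft (_▹_ {c = c} p i) y = graft p (node [] [ merge c y ])

raised-root : ∀ {T y} → SP (merge T y) → ∀ G → Raised T y G
raised-root sp G .via-imp {Γ} {Δ} {Σ' ⇒ Π} e i e' =
  contractʳ G i (saturate-imp G (unnest G (inI Γ Δ hole) (sp _ _ (merge-≼-imp e e'))))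
raised-root sp G .in-situ = sp G

raised-kid : ∀ {t c y} → c ∈ kids t → ∀ {G Γ Δ} → t ≼ (Γ ⇒ Δ) →
             Raised t (node [] [ merge c y ]) G → Raised c y (G ∘C inB Γ Δ hole)
raised-kid {t} i {G} {Γ} {Δ} e r .via-imp {Γ'} {Δ'} {Σ' ⇒ Π} ec j ey =
  contractʳ G' j (saturate-imp G' (nest G (inB Γ Δ hole) (inter-bc G (r .via-imp
    (≼-⊆ (id , skip₂) e) (there (here refl))
    (mk-emb (λ ()) λ { (here refl) → _ , here refl , merge-≼-imp ec ey })))))
  where G' = G ∘C inB Γ Δ hole
raised-kid {t} i {G} {Γ} {Δ} e r .in-situ S es = nest G (inB Γ Δ hole) (r .in-situ _
  (merge-≼ (↪-≼ (°↪ t) (≼-⊆ (id , there) e)) (mk-emb (λ ()) λ { (here refl) → _ , here refl , es })))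

-- The local argument `k` at the end of the path closes branches through `Raised`. Going back along
-- the path, `raised-kid` supplies this for a child from its parent, until only the root needs it,
-- where `raised-root` does.
graft-SP : ∀ {T t} (p : Path T t) {y} → (∀ G → Raised t y G → SPat t G) →
           SP (graft p y) → SP T
graft-SP []      k sp G = k G (raised-root sp G)
graft-SP (p ▹ i) k sp = graft-SP p k' sp
  where
  k' : ∀ G → Raised _ _ G → SPat _ G
  k' G r (Γ ⇒ Δ) e with emb-kid e i
  ... | s , j , es = contractʳ G j (unnest G (inB Γ Δ hole)
                       (k (G ∘C inB Γ Δ hole) (raised-kid i e r) s es))

-- What an implication successor must contain to refute an implication or a box.
seeds : SFm → List Tree
seeds (R (A ⊃ B)) = [ node (L A ∷ R B ∷ []) [] ]
seeds (R (□ A))   = [ node [] [ node [ R A ] [] ] ]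
seeds _           = []

open import Data.List.Membership.DecPropositional _≟_ using (_∈?_)

seed-SPat : ∀ {t y} X → X ∈ labels t → y ∈ seeds X → ∀ G → Raised t y G → SPat t G
seed-SPat {t} (R (A ⊃ B)) i (here refl) G r (Γ ⇒ Δ) e with A ∈? Γ
-- `⊃R₁` opens no implication block; this is the case that `in-situ` serves.
... | yes a = contractʳ G (emb-label e i) (⊃R₁ G a (r .in-situ _
      (merge-≼ (↪-≼ (°↪ t) (≼-⊆ (id , skip₂) e))
        (mk-emb (λ { (here refl) → a ; (there (here refl)) → there (here refl) }) λ ()))))
... | no ¬a = contractʳ G (emb-label e i) (⊃R₂ G ¬a (r .via-imp
      (≼-⊆ (id , skip₂) e) (there (here refl))
      (mk-emb (λ { (here refl) → here refl ; (there (here refl)) → here refl }) λ ())))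
seed-SPat (R (□ A)) i (here refl) G r (Γ ⇒ Δ) e =
  contractʳ G (emb-label e i) (□R G (r .via-imp
    (≼-⊆ (id , skip₂) e) (there (here refl))
    (mk-emb (λ ()) λ { (here refl) → _ , here refl , mk-emb (λ { (here refl) → here refl }) λ () })))

-- Saturation

-- One list per premise of the propositional rule for X, with the formulas which that premise
-- adds; an axiom has no premise, and [ [] ] stands for the absence of such a rule.
alts : SFm → List (List SFm)
alts (L ⊥')      = []
alts (L (A ∧ B)) = (L A ∷ L B ∷ []) ∷ []
alts (L (A ∨ B)) = [ L A ] ∷ [ L B ] ∷ []
alts (L (A ⊃ B)) = [ R A ] ∷ [ L B ] ∷ []
alts (R ⊤')      = []
alts (R (A ∧ B)) = [ R A ] ∷ [ R B ] ∷ []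
alts (R (A ∨ B)) = (R A ∷ R B ∷ []) ∷ []
alts _           = [ [] ]

push : SFm → List SFm
push (L (□ A)) = [ L A ]
push (R (◇ A)) = [ R A ]
push _         = []

spawn : SFm → List SFm
spawn (L (◇ A)) = [ L A ]
spawn _         = []

-- Left `⊥'` and right `⊤'` have no alternatives, so `Any` excludes these axioms. Right implications
-- and boxes demand nothing here; `Good` takes care of them.
data Sat : Tree → Set where
  sat : ∀ {l cs} →
        (∀ {X} → X ∈ l → Any (All (_∈ l)) (alts X)) →
        (∀ {p} → L (atom p) ∈ l → ¬ (R (atom p) ∈ l)) →
        (∀ {c} → c ∈ cs → concatMap push l ⊆ labels c) →
        (∀ {Y} → Y ∈ concatMap spawn l → ∃ λ c → c ∈ cs × Y ∈ labels c) →
        (∀ {c} → c ∈ cs → Sat c) →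
        Sat (node l cs)

expand : ∀ G X {S} → X ∈ˢ S →
         All (λ m → ∀ S' → S ⊆ˢ S' → All (_∈ˢ S') m → Prov (G ⟦ S' ⟧)) (alts X) →
         Prov (G ⟦ S ⟧)
expand G (L (atom p)) {Γ ⇒ Δ} i (h ∷ []) = h _ (id , id) []
expand G (L ⊥')       {Γ ⇒ Δ} i []       = contractˡ G i (ax⊥ G)
expand G (L ⊤')       {Γ ⇒ Δ} i (h ∷ []) = h _ (id , id) []
expand G (L (A ∧ B))  {Γ ⇒ Δ} i (h ∷ []) =
  contractˡ G i (∧L G (h _ ((λ j → there (skip₂ j)) , id) (here refl ∷ there (here refl) ∷ [])))
expand G (L (A ∨ B))  {Γ ⇒ Δ} i (h ∷ h' ∷ []) =
  contractˡ G i (∨L G (h _ (skip₂ , id) (here refl ∷ [])) (h' _ (skip₂ , id) (here refl ∷ [])))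
expand G (L (A ⊃ B))  {Γ ⇒ Δ} i (h ∷ h' ∷ []) =
  contractˡ G i (⊃L G (h _ (there , there) (here refl ∷ [])) (h' _ (skip₂ , id) (here refl ∷ [])))
expand G (L (□ A))    {Γ ⇒ Δ} i (h ∷ []) = h _ (id , id) []
expand G (L (◇ A))    {Γ ⇒ Δ} i (h ∷ []) = h _ (id , id) []
expand G (R (atom p)) {Γ ⇒ Δ} i (h ∷ []) = h _ (id , id) []
expand G (R ⊥')       {Γ ⇒ Δ} i (h ∷ []) = h _ (id , id) []
expand G (R ⊤')       {Γ ⇒ Δ} i []       = contractʳ G i (ax⊤ G)
expand G (R (A ∧ B))  {Γ ⇒ Δ} i (h ∷ h' ∷ []) =
  contractʳ G i (∧R G (h _ (id , skip₂) (there (here refl) ∷ []))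
                      (h' _ (id , skip₂) (there (here refl) ∷ [])))
expand G (R (A ∨ B))  {Γ ⇒ Δ} i (h ∷ []) =
  contractʳ G i (∨R G (h _ (id , λ j → there (skip₂ j))
    (there (here refl) ∷ there (there (here refl)) ∷ [])))
expand G (R (A ⊃ B))  {Γ ⇒ Δ} i (h ∷ []) = h _ (id , id) []
expand G (R (□ A))    {Γ ⇒ Δ} i (h ∷ []) = h _ (id , id) []
expand G (R (◇ A))    {Γ ⇒ Δ} i (h ∷ []) = h _ (id , id) []

infix 4 _⇐_

-- Stated context by context, not between instances of `SP`: in `kid-Red` the premises are available
-- only in the one context around the child.
_⇐_ : Tree → List Tree → Set
t ⇐ ts = ∀ G → All (λ u → SPat u G) ts → SPat t G

++-emb : ∀ {l m cs S} → node l cs ≼ S → All (_∈ˢ S) m → node (m ++ l) cs ≼ S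
++-emb {m = m} (emb f σ b e) a = emb (λ i → [ All.lookup a , f ]′ (∈-++⁻ m i)) σ b e

⇐-alts : ∀ {X l cs} → X ∈ l → node l cs ⇐ map (λ m → node (m ++ l) cs) (alts X)
⇐-alts {X} i G a S e = expand G X (emb-label e i)
  (All.map (λ h S' f m → h S' (++-emb (≼-⊆ f e) m)) (All.map⁻ a))

⇐-clash : ∀ {p l cs} → L (atom p) ∈ l → R (atom p) ∈ l → node l cs ⇐ []
⇐-clash i j G _ (Γ ⇒ Δ) e = contractˡʳ G (emb-label e i) (emb-label e j) (axp G)

add-kid : ∀ {l c cs s Γ Δ} → node l cs ≼ (Γ ⇒ Δ) → c ≼ s → node l (c ∷ cs) ≼ (Γ ⇒ box s ∷ Δ)
add-kid {l} {c} {cs} {s} {Γ} {Δ} e es = mk-emb (emb-label e') kid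
  where
  e' = ≼-⊆ {S' = Γ ⇒ box s ∷ Δ} (id , there) e
  kid : ∀ {d} → d ∈ c ∷ cs → ∃ λ s' → box s' ∈ box s ∷ Δ × d ≼ s'
  kid (here refl) = s , here refl , es
  kid (there i)   = emb-kid e' i

drop-kid : ∀ {l c cs S} → node l (c ∷ cs) ≼ S → node l cs ≼ S
drop-kid = ↪-≼ (sim-⊆ id there)

⇐-spawn : ∀ {X Y l cs} → X ∈ l → Y ∈ spawn X → node l cs ⇐ [ node l (node [ Y ] [] ∷ cs) ]
⇐-spawn {L (◇ A)} i (here refl) G (h ∷ []) (Γ ⇒ Δ) e =
  contractˡ G (emb-label e i) (◇L G (h _
    (≼-⊆ (there , id) (add-kid e (mk-emb (λ { (here refl) → here refl }) λ ())))))

⇐-push : ∀ {X Y l m ds cs} → X ∈ l → Y ∈ push X →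
         node l (node m ds ∷ cs) ⇐ [ node l (node (Y ∷ m) ds ∷ cs) ]
⇐-push {X} {l = l} {m} {ds} {cs} i k G (h ∷ []) (Γ ⇒ Δ) e with emb-kid e (here refl)
⇐-push {L (□ A)} i (here refl) G (h ∷ []) (Γ ⇒ Δ) e | (Σ' ⇒ Π) , j , es =
  contractˡʳ G (emb-label e i) j (□L G (h _ (≼-⊆ (there , id) (add-kid (drop-kid e)
    (++-emb (≼-⊆ (there , id) es) (here refl ∷ []))))))
⇐-push {R (◇ A)} {l = l} {m} {ds} {cs} i (here refl) G (h ∷ []) (Γ ⇒ Δ) e | (Σ' ⇒ Π) , j , es =
  resp G id id skip₂ (absorb (emb-label e i) ∘ ∷⁺ʳ _ (absorb j)) (◇R G (h _
    (≼-⊆ (id , there) (add-kid (drop-kid e) (++-emb (≼-⊆ (id , there) es) (here refl ∷ []))))))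

-- Finite covers

-- A partial derivation of `t`, recorded by its open leaves and composed by `ret` and `bind`.
record Red (Q : Tree → Set) (t : Tree) : Set where
  constructor cover
  field
    {members} : List Tree
    all-good  : All Q members
    sound     : t ⇐ members

ret : ∀ {Q : Tree → Set} {t} → Q t → Red Q t
ret q = cover (q ∷ []) λ { G (h ∷ []) → h }

map-Red : ∀ {P Q : Tree → Set} {t} → (∀ {u} → P u → Q u) → Red P t → Red Q t
map-Red f (cover ps c) = cover (All.map f ps) c

weaken-Red : ∀ {Q : Tree → Set} {t u} → t ↪ u → Red Q t → Red Q u
weaken-Red s (cover qs c) = cover qs λ G a S e → c G a S (↪-≼ s e)

bind : ∀ {P Q : Tree → Set} {t} → Red P t → (∀ {u} → P u → Red Q u) → Red Q t
bind {P} {Q} (cover ps c) k =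
  let us , qs , f = go ps in cover qs λ G a → c G (f G a)
  where
  go : ∀ {ts} → All P ts →
       ∃ λ us → All Q us × (∀ G → All (λ u → SPat u G) us → All (λ u → SPat u G) ts)
  go []       = [] , [] , λ _ _ → []
  go (p ∷ ps) =
    let cover {us} qs c = k p ; vs , rs , f = go ps in
    us ++ vs , All.++⁺ qs rs , λ G a → c G (All.++⁻ˡ us a) ∷ f G (All.++⁻ʳ us a)

branch : ∀ {Q : Tree → Set} {t ts} → t ⇐ ts → All (Red Q) ts → Red Q t
branch c rs = bind (cover rs c) id

-- The cover of the child works in every context, hence inside the modal block hosting it.
kid-Red : ∀ {P Q : Tree → Set} {l c cs} → (∀ {d} → P d → Q (node l (d ∷ cs))) →
          Red P c → Red Q (node l (c ∷ cs))
kid-Red {l = l} {c} {cs} f (cover {ts} ps h) = cover (All.map⁺ (All.map f ps)) sound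
  where
  sound : node l (c ∷ cs) ⇐ map (λ d → node l (d ∷ cs)) ts
  sound G a (Γ ⇒ Δ) e with emb-kid e (here refl)
  ... | s , j , es = contractʳ G j (unnest G (inB Γ Δ hole) (h _
        (All.map (λ k S' e' → nest G (inB Γ Δ hole) (k _ (add-kid (drop-kid e) e'))) (All.map⁻ a))
        s es))

run : ∀ {Q : Tree → Set} {C : Set} {t} → Red Q t → (∀ {u} → Q u → SP u ⊎ C) → SP t ⊎ C
run {Q} {C} (cover qs c) k = map₁ (λ h G → c G (All.map (λ sp → sp G) h)) (go qs)
  where
  go : ∀ {ts} → All Q ts → All SP ts ⊎ C
  go []       = inj₁ []
  go (q ∷ qs) with k q | go qs
  ... | inj₂ x | _      = inj₂ x
  ... | inj₁ _ | inj₂ x = inj₂ x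
  ... | inj₁ s | inj₁ h = inj₁ (s ∷ h)

pushes : ∀ {Q : Tree → Set} {l m ds cs} ys → ys ⊆ concatMap push l →
         Red Q (node l (node (ys ++ m) ds ∷ cs)) → Red Q (node l (node m ds ∷ cs))
pushes []       f r = r
pushes {l = l} (y ∷ ys) f r with find (∈-concatMap⁻ push {xs = l} (f (here refl)))
... | X , i , j = pushes ys (f ∘ there) (branch (⇐-push i j) (r ∷ []))

seedling : SFm → Tree
seedling Y = node [ Y ] []

spawns : ∀ {Q : Tree → Set} {l cs} ys → ys ⊆ concatMap spawn l →
         Red Q (node l (map seedling ys ++ cs)) → Red Q (node l cs)
spawns []       f r = r
spawns {l = l} (y ∷ ys) f r with find (∈-concatMap⁻ spawn {xs = l} (f (here refl)))
... | X , i , j = spawns ys (f ∘ there) (branch (⇐-spawn i j) (r ∷ []))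

-- Detecting clashes.

_≟ₛ_ : (X Y : SFm) → Dec (X ≡ Y)
L A ≟ₛ L B = map′ (cong L) (λ { refl → refl }) (A ≟ B)
R A ≟ₛ R B = map′ (cong R) (λ { refl → refl }) (A ≟ B)
L A ≟ₛ R B = no λ ()
R A ≟ₛ L B = no λ ()

open import Data.List.Membership.DecPropositional _≟ₛ_ using () renaming (_∈?_ to _∈ₛ?_)

Clashes : List SFm → SFm → Set
Clashes l (L (atom p)) = R (atom p) ∈ l
Clashes l _            = ⊥

clashes? : ∀ l X → Dec (Clashes l X)
clashes? l (L (atom p)) = R (atom p) ∈ₛ? l
clashes? l (L ⊥')       = no id
clashes? l (L ⊤')       = no id
clashes? l (L (A ∧ B))  = no id
clashes? l (L (A ∨ B))  = no id
clashes? l (L (A ⊃ B))  = no id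
clashes? l (L (□ A))    = no id
clashes? l (L (◇ A))    = no id
clashes? l (R A)        = no id

clash? : ∀ l → (∃ λ p → L (atom p) ∈ l × R (atom p) ∈ l) ⊎
               (∀ {p} → L (atom p) ∈ l → ¬ (R (atom p) ∈ l))
clash? l with Any.any? (clashes? l) l
... | no ¬c = inj₂ λ i j → ¬c (lose i j)
... | yes c with find c
...   | L (atom p) , i , j = inj₁ (p , i , j)

-- Subsets of a finite set

pow : ∀ {X : Set} → List X → List (List X)
pow []       = [ [] ]
pow (x ∷ xs) = pow xs ++ map (x ∷_) (pow xs)

pow-⊆ : ∀ {X : Set} (xs : List X) {ys} → ys ∈ pow xs → ys ⊆ xs
pow-⊆ []       (here refl) ()
pow-⊆ (x ∷ xs) i j with ∈-++⁻ (pow xs) i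
... | inj₁ i' = there (pow-⊆ xs i' j)
... | inj₂ i' with ∈-map⁻ (x ∷_) i' | j
...   | _ , k , refl | here e   = here e
...   | _ , k , refl | there j' = there (pow-⊆ xs k j')

[]∈pow : ∀ {X : Set} (xs : List X) → [] ∈ pow xs
[]∈pow []       = here refl
[]∈pow (x ∷ xs) = ∈-++⁺ˡ ([]∈pow xs)

pow-insert : ∀ {X : Set} (xs : List X) {y ys} → y ∈ xs → ys ∈ pow xs →
             ∃ λ zs → zs ∈ pow xs × zs ⊆ y ∷ ys × y ∷ ys ⊆ zs
pow-insert (x ∷ xs) i j with ∈-++⁻ (pow xs) j
pow-insert (x ∷ xs) (here refl) j | inj₁ j' = _ , ∈-++⁺ʳ (pow xs) (∈-map⁺ (x ∷_) j') , id , id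
pow-insert (x ∷ xs) (there i)   j | inj₁ j' =
  let zs , k , f , g = pow-insert xs i j' in zs , ∈-++⁺ˡ k , f , g
pow-insert (x ∷ xs) i j | inj₂ j' with ∈-map⁻ (x ∷_) j' | i
... | ys , k , refl | here refl = x ∷ ys , j , there , absorb (here refl)
... | ys , k , refl | there i'  =
  let zs , k' , f , g = pow-insert xs i' k in
  x ∷ zs , ∈-++⁺ʳ (pow xs) (∈-map⁺ (x ∷_) k') , swap ∘ ∷⁺ʳ x f , ∷⁺ʳ x g ∘ swap
  where
  swap : ∀ {a b} {zs : List _} → (a ∷ b ∷ zs) ⊆ (b ∷ a ∷ zs)
  swap (here e)          = there (here e)
  swap (there (here e))  = here e
  swap (there (there i)) = there (there i)

-- `pow` lists subsequences, so an arbitrary list is matched only up to order and repetition.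
pow-complete : ∀ {X : Set} (xs ys : List X) → ys ⊆ xs → ∃ λ zs → zs ∈ pow xs × zs ⊆ ys × ys ⊆ zs
pow-complete xs []       f = [] , []∈pow xs , id , id
pow-complete xs (y ∷ ys) f =
  let zs , i , g , h    = pow-complete xs ys (f ∘ there)
      zs' , i' , g' , h' = pow-insert xs (f (here refl)) i
  in zs' , i' , ∷⁺ʳ y g ∘ g' , h' ∘ ∷⁺ʳ y h

-- Subformulas and modal degree

deg : Fm → ℕ
deg (atom _) = 0
deg ⊥'       = 0
deg ⊤'       = 0
deg (A ∧ B)  = deg A ⊔ deg B
deg (A ∨ B)  = deg A ⊔ deg B
deg (A ⊃ B)  = deg A ⊔ deg B
deg (□ A)    = suc (deg A)
deg (◇ A)    = suc (deg A)

parts : Fm → List Fm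
parts (A ∧ B) = A ∷ B ∷ []
parts (A ∨ B) = A ∷ B ∷ []
parts (A ⊃ B) = A ∷ B ∷ []
parts (□ A)   = [ A ]
parts (◇ A)   = [ A ]
parts _       = []

mutual
  sub : Fm → List Fm
  sub A = A ∷ proper A

  proper : Fm → List Fm
  proper (A ∧ B) = sub A ++ sub B
  proper (A ∨ B) = sub A ++ sub B
  proper (A ⊃ B) = sub A ++ sub B
  proper (□ A)   = sub A
  proper (◇ A)   = sub A
  proper _       = []

parts⊆proper : ∀ A → parts A ⊆ proper A
parts⊆proper (A ∧ B) (here refl)         = here refl
parts⊆proper (A ∧ B) (there (here refl)) = ∈-++⁺ʳ (sub A) (here refl)
parts⊆proper (A ∨ B) (here refl)         = here refl
parts⊆proper (A ∨ B) (there (here refl)) = ∈-++⁺ʳ (sub A) (here refl)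
parts⊆proper (A ⊃ B) (here refl)         = here refl
parts⊆proper (A ⊃ B) (there (here refl)) = ∈-++⁺ʳ (sub A) (here refl)
parts⊆proper (□ A)   (here refl)         = here refl
parts⊆proper (◇ A)   (here refl)         = here refl

mutual
  sub-parts : ∀ A {X Y} → X ∈ sub A → Y ∈ parts X → Y ∈ sub A
  sub-parts A (here refl) j = there (parts⊆proper A j)
  sub-parts A (there i)   j = there (proper-parts A i j)

  proper-parts : ∀ A {X Y} → X ∈ proper A → Y ∈ parts X → Y ∈ proper A
  proper-parts (A ∧ B) = ++-parts A B
  proper-parts (A ∨ B) = ++-parts A B
  proper-parts (A ⊃ B) = ++-parts A B
  proper-parts (□ A)   = sub-parts A
  proper-parts (◇ A)   = sub-parts A

  ++-parts : ∀ A B {X Y} → X ∈ sub A ++ sub B → Y ∈ parts X → Y ∈ sub A ++ sub B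
  ++-parts A B i j with ∈-++⁻ (sub A) i
  ... | inj₁ i' = ∈-++⁺ˡ (sub-parts A i' j)
  ... | inj₂ i' = ∈-++⁺ʳ (sub A) (sub-parts B i' j)

unsign : SFm → Fm
unsign (L A) = A
unsign (R A) = A

degₛ : SFm → ℕ
degₛ = deg ∘ unsign

_∈parts_ : SFm → SFm → Set
Y ∈parts X = unsign Y ∈ parts (unsign X)

alts-parts : ∀ X → All (All (λ Y → Y ∈parts X × degₛ Y ℕ.≤ degₛ X)) (alts X)
alts-parts (L (atom p)) = [] ∷ []
alts-parts (L ⊥')       = []
alts-parts (L ⊤')       = [] ∷ []
alts-parts (L (A ∧ B))  =
  ((here refl , ℕ.m≤m⊔n _ _) ∷ (there (here refl) , ℕ.m≤n⊔m (deg A) _) ∷ []) ∷ []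
alts-parts (L (A ∨ B))  =
  ((here refl , ℕ.m≤m⊔n _ _) ∷ []) ∷ ((there (here refl) , ℕ.m≤n⊔m (deg A) _) ∷ []) ∷ []
alts-parts (L (A ⊃ B))  =
  ((here refl , ℕ.m≤m⊔n _ _) ∷ []) ∷ ((there (here refl) , ℕ.m≤n⊔m (deg A) _) ∷ []) ∷ []
alts-parts (L (□ A))    = [] ∷ []
alts-parts (L (◇ A))    = [] ∷ []
alts-parts (R (atom p)) = [] ∷ []
alts-parts (R ⊥')       = [] ∷ []
alts-parts (R ⊤')       = []
alts-parts (R (A ∧ B))  =
  ((here refl , ℕ.m≤m⊔n _ _) ∷ []) ∷ ((there (here refl) , ℕ.m≤n⊔m (deg A) _) ∷ []) ∷ []
alts-parts (R (A ∨ B))  =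
  ((here refl , ℕ.m≤m⊔n _ _) ∷ (there (here refl) , ℕ.m≤n⊔m (deg A) _) ∷ []) ∷ []
alts-parts (R (A ⊃ B))  = [] ∷ []
alts-parts (R (□ A))    = [] ∷ []
alts-parts (R (◇ A))    = [] ∷ []

push-parts : ∀ X {Y} → Y ∈ push X → Y ∈parts X × suc (degₛ Y) ≡ degₛ X
push-parts (L (□ A)) (here refl) = here refl , refl
push-parts (R (◇ A)) (here refl) = here refl , refl

spawn-parts : ∀ X {Y} → Y ∈ spawn X → Y ∈parts X × suc (degₛ Y) ≡ degₛ X
spawn-parts (L (◇ A)) (here refl) = here refl , refl

-- Paths ordered by simulation

-- Worlds are paths and not just their ends because (BC) asks for a predecessor of the larger world
-- that lies above the given one; the path remembers it.
data _≤P_ : ∀ {T t T' t'} → Path T t → Path T' t' → Set where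
  []  : ∀ {T T'} → T ⊴ T' → [] {T} ≤P [] {T'}
  _▹_ : ∀ {T t c T' t' c'} {p : Path T t} {p' : Path T' t'} {i : c ∈ kids t} {i' : c' ∈ kids t'} →
        p ≤P p' → c ⊴ c' → (p ▹ i) ≤P (p' ▹ i')

≤P-end : ∀ {T t T' t'} {p : Path T t} {p' : Path T' t'} → p ≤P p' → t ⊴ t'
≤P-end ([] s)  = s
≤P-end (_ ▹ s) = s

≤P-refl : ∀ {T t} (p : Path T t) → p ≤P p
≤P-refl []      = [] (sim-refl _)
≤P-refl (p ▹ i) = ≤P-refl p ▹ sim-refl _

≤P-trans : ∀ {T t T' t' T'' t''} {p : Path T t} {q : Path T' t'} {r : Path T'' t''} →
           p ≤P q → q ≤P r → p ≤P r
≤P-trans ([] s)   ([] s')   = [] (sim-trans s s')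
≤P-trans (le ▹ s) (le' ▹ s') = ≤P-trans le le' ▹ sim-trans s s'

merge-↪⁻ : ∀ {t y u} → merge t y ↪ u → t ⊴ u × y ↪ u
merge-↪⁻ {node l cs} {node m ds} {u} s =
  °↪⇒⊴ (sim-trans (sim-⊆ (∈-++⁺ʳ m) (∈-++⁺ʳ ds)) s) , sim-trans (sim-⊆ ∈-++⁺ˡ ∈-++⁺ˡ) s

-- Each level of `graft` is a merge, and splitting it yields one step of the path above `p`.
graft-↪⁻ : ∀ {T t} (p : Path T t) {y T'} → graft p y ↪ T' →
           ∃ λ t' → Σ (Path T' t') λ p' → p ≤P p' × y ↪ t'
graft-↪⁻ []      s = let a , b = merge-↪⁻ s in _ , [] , [] a , b
graft-↪⁻ (p ▹ i) s =
  let t' , p' , le , e = graft-↪⁻ p s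
      c' , j , e'      = sim-kid e (here refl)
      a , b            = merge-↪⁻ e'
  in c' , p' ▹ j , le ▹ a , b

all-or : ∀ {X C : Set} {P : X → Set} xs → (∀ {x} → x ∈ xs → P x ⊎ C) → (∀ {x} → x ∈ xs → P x) ⊎ C
all-or []       f = inj₁ λ ()
all-or (x ∷ xs) f with f (here refl) | all-or xs (f ∘ there)
... | inj₂ c | _      = inj₂ c
... | inj₁ _ | inj₂ c = inj₂ c
... | inj₁ p | inj₁ h = inj₁ λ { (here refl) → p ; (there i) → h i }

_◃_ : ∀ {T c t} → c ∈ kids T → Path c t → Path T t
i ◃ []      = [] ▹ i
i ◃ (q ▹ j) = (i ◃ q) ▹ j

-- Paths grow at the end, but the exhaustive search descends from the root and needs the first step.
data Uncons {T} : ∀ {t} → Path T t → Set where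
  []   : Uncons []
  cons : ∀ {c t} (i : c ∈ kids T) (q : Path c t) → Uncons (i ◃ q)

uncons : ∀ {T t} (p : Path T t) → Uncons p
uncons []      = []
uncons (p ▹ i) with uncons p
... | []       = cons i []
... | cons j q = cons j (q ▹ i)

mutual
  paths-or : ∀ {C : Set} T (P : ∀ {t} → Path T t → Set) →
             (∀ {t} (p : Path T t) → P p ⊎ C) → (∀ {t} (p : Path T t) → P p) ⊎ C
  paths-or (node l cs) P f with f [] | kids-or cs (λ i q → P (i ◃ q)) (λ i q → f (i ◃ q))
  ... | inj₂ c | _      = inj₂ c
  ... | inj₁ _ | inj₂ c = inj₂ c
  ... | inj₁ p | inj₁ h = inj₁ λ q → go (uncons q)
    where
    go : ∀ {t} {q : Path (node l cs) t} → Uncons q → P q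
    go []         = p
    go (cons i q) = h i q

  kids-or : ∀ {C : Set} cs (P : ∀ {c} → c ∈ cs → ∀ {t} → Path c t → Set) →
            (∀ {c} (i : c ∈ cs) {t} (p : Path c t) → P i p ⊎ C) →
            (∀ {c} (i : c ∈ cs) {t} (p : Path c t) → P i p) ⊎ C
  kids-or []       P f = inj₁ λ ()
  kids-or (c ∷ cs) P f with paths-or c (P (here refl)) (f (here refl))
                          | kids-or cs (λ i → P (there i)) (λ i → f (there i))
  ... | inj₂ c | _      = inj₂ c
  ... | inj₁ _ | inj₂ c = inj₂ c
  ... | inj₁ p | inj₁ h = inj₁ λ { (here refl) → p ; (there i) → h i }

-- Removal of a list member.

remove : ∀ {X : Set} {x : X} xs → x ∈ xs → List X
remove (x ∷ xs) (here _)  = xs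
remove (x ∷ xs) (there i) = x ∷ remove xs i

length-remove : ∀ {X : Set} {x : X} xs (i : x ∈ xs) → length xs ≡ suc (length (remove xs i))
length-remove (x ∷ xs) (here _)  = refl
length-remove (x ∷ xs) (there i) = cong suc (length-remove xs i)

remove-⊆ : ∀ {X : Set} {x : X} xs (i : x ∈ xs) → remove xs i ⊆ xs
remove-⊆ (x ∷ xs) (here _)  j         = there j
remove-⊆ (x ∷ xs) (there i) (here e)  = here e
remove-⊆ (x ∷ xs) (there i) (there j) = there (remove-⊆ xs i j)

∈-remove : ∀ {X : Set} {x y : X} xs (i : x ∈ xs) → y ∈ xs → y ≡ x ⊎ y ∈ remove xs i
∈-remove (x ∷ xs) (here refl) (here e)  = inj₁ e
∈-remove (x ∷ xs) (here refl) (there j) = inj₂ j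
∈-remove (x ∷ xs) (there i)   (here e)  = inj₂ (here e)
∈-remove (x ∷ xs) (there i)   (there j) = map₂ there (∈-remove xs i j)

-- Witnesses and good trees.

record Witness (alive : List Tree) {T t} (p : Path T t) (y : Tree) : Set where
  constructor witness
  field
    {root end} : Tree
    root∈      : root ∈ alive
    root-sat   : Sat root
    path       : Path root end
    above      : p ≤P path
    contains   : y ↪ end

GoodAt : List Tree → ∀ {T t} → Path T t → Set
GoodAt alive {T} {t} p = ∀ {X} → X ∈ labels t → ∀ {y} → y ∈ seeds X → Witness alive p y

Good : List Tree → Tree → Set
Good alive T = ∀ {t} (p : Path T t) → GoodAt alive p

sat-kid : ∀ {t c} → Sat t → c ∈ kids t → Sat c
sat-kid (sat _ _ _ _ s) = s

sat-end : ∀ {T t} → Sat T → Path T t → Sat t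
sat-end s []      = s
sat-end s (p ▹ i) = sat-kid (sat-end s p) i

sat-alts : ∀ {t X} → Sat t → X ∈ labels t → Any (All (_∈ labels t)) (alts X)
sat-alts (sat a _ _ _ _) = a

sat-push : ∀ {t X Y c} → Sat t → X ∈ labels t → Y ∈ push X → c ∈ kids t → Y ∈ labels c
sat-push (sat _ _ f _ _) i j k = f k (∈-concatMap⁺ push (lose i j))

sat-spawn : ∀ {t X Y} → Sat t → X ∈ labels t → Y ∈ spawn X → ∃ λ c → c ∈ kids t × Y ∈ labels c
sat-spawn (sat _ _ _ f _) i j = f (∈-concatMap⁺ spawn (lose i j))

sat-atom : ∀ {t p} → Sat t → L (atom p) ∈ labels t → ¬ (R (atom p) ∈ labels t)
sat-atom (sat _ f _ _ _) = f

-- Countermodels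

module Countermodel (alive : List Tree) (good : ∀ {T} → T ∈ alive → Good alive T) where

  -- Saturation of the root is asked for separately, since `alive` may retain unsaturated trees.
  record World : Set where
    constructor world
    field
      {root end} : Tree
      root∈      : root ∈ alive
      root-sat   : Sat root
      path       : Path root end

    end-sat : Sat end
    end-sat = sat-end root-sat path

  open World

  data _⟶_ : World → World → Set where
    step : ∀ {T t c} {m : T ∈ alive} {s : Sat T} {p : Path T t} (i : c ∈ kids t) →
           world m s p ⟶ world m s (p ▹ i)

  model : Model
  model = record
    { W       = World
    ; _≤_     = λ w v → path w ≤P path v
    ; ≤-refl  = ≤P-refl _
    ; ≤-trans = ≤P-trans
    ; R       = _⟶_
    ; V       = λ w p → L (atom p) ∈ labels (end w)
    ; V-mono  = λ le i → sim-labels (≤P-end le) i isL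
    ; FC      = fc
    ; BC      = bc
    }
    where
    fc : ∀ {w w' v} → path w ≤P path w' → w ⟶ v → Σ World λ v' → (w' ⟶ v') × path v ≤P path v'
    fc {w' = world m s p'} le (step i) =
      let c' , i' , e = sim-kid (≤P-end le) i in world m s (p' ▹ i') , step i' , le ▹ e
    bc : ∀ {w v v'} → w ⟶ v → path v ≤P path v' → Σ World λ w' → path w ≤P path w' × (w' ⟶ v')
    -- By the form of `_≤P_` the larger path also ends in a step; dropping it gives the predecessor.
    bc {v' = world m s (p' ▹ i')} (step i) (le ▹ e) = world m s p' , le , step i'

  mutual
    -- The truth lemma, by induction on the formula. Its halves are mutual because implications
    -- switch sides.
    forced : ∀ A w → L A ∈ labels (end w) → _⊩_ model w A
    forced (atom p) w i = i
    forced ⊥'       w i with () ← sat-alts (end-sat w) i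
    forced ⊤'       w i = tt
    forced (A ∧ B)  w i with here (a ∷ b ∷ []) ← sat-alts (end-sat w) i =
      forced A w a , forced B w b
    forced (A ∨ B)  w i with sat-alts (end-sat w) i
    ... | here (a ∷ [])         = inj₁ (forced A w a)
    ... | there (here (b ∷ [])) = inj₂ (forced B w b)
    -- The label is first carried up to `w'`, whose own saturation selects the alternative.
    forced (A ⊃ B)  w i w' le h with sat-alts (end-sat w') (sim-labels (≤P-end le) i isL)
    ... | here (a ∷ [])         = ⊥-elim (refuted A w' a h)
    ... | there (here (b ∷ [])) = forced B w' b
    forced (□ A)    w i w' v' le (step j) =
      forced A v' (sat-push (end-sat w') (sim-labels (≤P-end le) i isL) (here refl) j)
    forced (◇ A)    (world m s p) i =
      let c , j , k = sat-spawn (sat-end s p) i (here refl)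
      in world m s (p ▹ j) , step j , forced A (world m s (p ▹ j)) k

    refuted : ∀ A w → R A ∈ labels (end w) → ¬ (_⊩_ model w A)
    refuted (atom p) w i h = sat-atom (end-sat w) h i
    refuted ⊥'       w i h = h
    refuted ⊤'       w i h with () ← sat-alts (end-sat w) i
    refuted (A ∧ B)  w i (h , h') with sat-alts (end-sat w) i
    ... | here (a ∷ [])         = refuted A w a h
    ... | there (here (b ∷ [])) = refuted B w b h'
    refuted (A ∨ B)  w i h with here (a ∷ b ∷ []) ← sat-alts (end-sat w) i =
      [ refuted A w a , refuted B w b ]′ h
    refuted (A ⊃ B)  (world m s p) i h with good m p i (here refl)
    ... | witness m' s' p' le e =
      refuted B w' (sim-labels e (there (here refl)) tt)
        (h w' le (forced A w' (sim-labels e (here refl) tt)))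
      where w' = world m' s' p'
    refuted (□ A)    (world m s p) i h with good m p i (here refl)
    ... | witness m' s' p' le e with sim-kid e (here refl)
    ... | c , j , e' = refuted A (world m' s' (p' ▹ j)) (sim-labels e' (here refl) tt)
                         (h (world m' s' p') _ le (step j))
    refuted (◇ A)    w i (v , step j , h) = refuted A v (sat-push (end-sat w) i (here refl) j) h

-- Elimination

-- The members of Ex are exempt from the saturation condition.
Done : (SFm → Set) → List SFm → Set
Done Ex l = ∀ {X} → X ∈ l → Any (All (_∈ l)) (alts X) ⊎ Ex X

module Search (A₀ : Fm) where

  F : ℕ → List SFm
  F k = filter (λ X → degₛ X ℕ.≤? k) (map L (sub A₀) ++ map R (sub A₀))

  ∈F⁺ : ∀ {k} X → unsign X ∈ sub A₀ → degₛ X ℕ.≤ k → X ∈ F k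
  ∈F⁺ (L A) i d = ∈-filter⁺ (λ X → degₛ X ℕ.≤? _) (∈-++⁺ˡ (∈-map⁺ L i)) d
  ∈F⁺ (R A) i d = ∈-filter⁺ (λ X → degₛ X ℕ.≤? _) (∈-++⁺ʳ (map L (sub A₀)) (∈-map⁺ R i)) d

  ∈F⁻ : ∀ {k X} → X ∈ F k → unsign X ∈ sub A₀ × degₛ X ℕ.≤ k
  ∈F⁻ {k} i with ∈-filter⁻ (λ X → degₛ X ℕ.≤? k) {xs = map L (sub A₀) ++ map R (sub A₀)} i
  ... | j , d with ∈-++⁻ (map L (sub A₀)) j
  ... | inj₁ j' with _ , m , refl ← ∈-map⁻ L j' = m , d
  ... | inj₂ j' with _ , m , refl ← ∈-map⁻ R j' = m , d

  -- Labels allowed one modal level down; none at degree 0, where trees have no children.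
  KF : ℕ → List SFm
  KF zero    = []
  KF (suc k) = F k

  F-alts : ∀ {k X} → X ∈ F k → All (All (_∈ F k)) (alts X)
  F-alts {k} {X} i =
    let j , d = ∈F⁻ i in
    All.map (All.map λ {Y} (p , d') → ∈F⁺ Y (sub-parts A₀ j p) (ℕ.≤-trans d' d)) (alts-parts X)

  F-modal : ∀ k {X Y} → X ∈ F k → Y ∈parts X → suc (degₛ Y) ≡ degₛ X → Y ∈ KF k
  F-modal k {X} {Y} i p e with ∈F⁻ i
  ... | j , d rewrite sym e with d
  ... | s≤s d' = ∈F⁺ Y (sub-parts A₀ j p) d'

  mutual
    WF : ℕ → Tree → Set
    WF k (node l cs) = All (_∈ F k) l × All (Kid k) cs

    Kid : ℕ → Tree → Set
    Kid zero    _ = ⊥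
    Kid (suc k) t = WF k t

  mutual
    -- The degree bound drops at each level, so choosing subsets level by level exhausts the bounded
    -- trees up to set equality.
    E : ℕ → List Tree
    E k = cartesianProductWith node (pow (F k)) (pow (K k))

    K : ℕ → List Tree
    K zero    = []
    K (suc k) = E k

  mutual
    E-WF : ∀ k {t} → t ∈ E k → WF k t
    E-WF k i with ∈-cartesianProductWith⁻ node (pow (F k)) (pow (K k)) i
    ... | l , cs , a , b , refl =
      All.tabulate (pow-⊆ (F k) a) , All.tabulate (λ j → K-Kid k (pow-⊆ (K k) b j))

    K-Kid : ∀ k {t} → t ∈ K k → Kid k t
    K-Kid (suc k) i = E-WF k i

  -- Saturation within the finite list.

  module _ (k : ℕ) where

    Resolved : (SFm → Set) → List SFm → List Tree → Tree → Set
    Resolved Ex l cs t = ∃ λ l' → t ≡ node l' cs × l ⊆ l' × All (_∈ F k) l' × Done Ex l'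

    -- X counts as a permitted defect until its alternatives have been dealt with.
    Resolver : SFm → Set₁
    Resolver X = ∀ {Ex l cs} → X ∈ l → All (_∈ F k) l → Done (λ Y → Y ≡ X ⊎ Ex Y) l →
                 Red (Resolved Ex l cs) (node l cs)

    resolve-all : ∀ {m} → All Resolver m → ∀ {Ex l cs} → m ⊆ l → All (_∈ F k) l →
                  Done (λ Y → Y ∈ m ⊎ Ex Y) l → Red (Resolved Ex l cs) (node l cs)
    resolve-all []       f w d =
      ret (_ , refl , (λ i → i) , w , λ i → [ inj₁ , [ (λ ()) , inj₂ ]′ ]′ (d i))
    resolve-all (r ∷ rs) f w d =
      bind (r (f (here refl)) w (λ i → map₂ split (d i))) λ { (l' , refl , g , w' , d') →
      map-Red (λ { (l'' , e , g' , z) → l'' , e , g' ∘ g , z })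
        (resolve-all rs (g ∘ f ∘ there) w' d') }
      where
      split : ∀ {X Y : SFm} {m} {B : Set} → Y ∈ X ∷ m ⊎ B → Y ≡ X ⊎ (Y ∈ m ⊎ B)
      split (inj₁ (here e))  = inj₁ e
      split (inj₁ (there i)) = inj₂ (inj₁ i)
      split (inj₂ b)         = inj₂ (inj₂ b)

    -- Adding an alternative settles `X`, and the only new defects are the added formulas, which
    -- have resolvers.
    resolve-via : ∀ X → All (All Resolver) (alts X) → Resolver X
    resolve-via X rs {Ex} {l} {cs} i w d = branch (⇐-alts i) (All.map⁺ (All.tabulate choose))
      where
      choose : ∀ {m} → m ∈ alts X → Red (Resolved Ex l cs) (node (m ++ l) cs)
      choose {m} j = map-Red
        (λ { (l' , e , g , w' , d') → l' , e , g ∘ ∈-++⁺ʳ m , w' , λ i' →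
             [ inj₁ , [ (λ { refl → inj₁ (lose j (All.tabulate (g ∘ ∈-++⁺ˡ))) }) , inj₂ ]′ ]′ (d' i') })
        (resolve-all (All.lookup rs j) ∈-++⁺ˡ
          (All.++⁺ (All.lookup (F-alts (All.lookup w i)) j) w)
          λ i' → [ (λ a → inj₂ (inj₁ a)) , (λ a → ⊎-map (Any.map (All.map (∈-++⁺ʳ m))) inj₂ (d a)) ]′
            (∈-++⁻ m i'))

    mutual
      -- Alternatives consist of immediate subformulas, so recursion on the formula suffices.
      resolveL : ∀ A → Resolver (L A)
      resolveL (atom p) = resolve-via _ ([] ∷ [])
      resolveL ⊥'       = resolve-via _ []
      resolveL ⊤'       = resolve-via _ ([] ∷ [])
      resolveL (A ∧ B)  = resolve-via _ ((resolveL A ∷ resolveL B ∷ []) ∷ [])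
      resolveL (A ∨ B)  = resolve-via _ ((resolveL A ∷ []) ∷ (resolveL B ∷ []) ∷ [])
      resolveL (A ⊃ B)  = resolve-via _ ((resolveR A ∷ []) ∷ (resolveL B ∷ []) ∷ [])
      resolveL (□ A)    = resolve-via _ ([] ∷ [])
      resolveL (◇ A)    = resolve-via _ ([] ∷ [])

      resolveR : ∀ A → Resolver (R A)
      resolveR (atom p) = resolve-via _ ([] ∷ [])
      resolveR ⊥'       = resolve-via _ ([] ∷ [])
      resolveR ⊤'       = resolve-via _ []
      resolveR (A ∧ B)  = resolve-via _ ((resolveR A ∷ []) ∷ (resolveR B ∷ []) ∷ [])
      resolveR (A ∨ B)  = resolve-via _ ((resolveR A ∷ resolveR B ∷ []) ∷ [])
      resolveR (A ⊃ B)  = resolve-via _ ([] ∷ [])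
      resolveR (□ A)    = resolve-via _ ([] ∷ [])
      resolveR (◇ A)    = resolve-via _ ([] ∷ [])

    resolver : ∀ X → Resolver X
    resolver (L A) = resolveL A
    resolver (R A) = resolveR A

    resolve : ∀ {l cs} → All (_∈ F k) l → Red (Resolved (λ _ → ⊥) l cs) (node l cs)
    resolve w = resolve-all (All.tabulate (λ {X} _ → resolver X)) id w (λ i → inj₂ (inj₁ i))

    SatExt : (Tree → Set) → Tree → Tree → Set
    SatExt P t u = P u × Sat u × t ↪ u

    module _ (sat-kids : ∀ {c} → Kid k c → Red (SatExt (_∈ K k) c) c) where

      KidOK : List SFm → Tree → Set
      KidOK l c = c ∈ K k × Sat c × concatMap push l ⊆ labels c

      Grown : List SFm → List Tree → List Tree → Tree → Set
      Grown l cs done t = ∃ λ ds →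
        t ≡ node l ds × All (KidOK l) ds × (∀ {c} → c ∈ cs → ∃ λ d → d ∈ ds × c ↪ d) × done ⊆ ds

      kid-++ : ∀ {m c} → m ⊆ KF k → Kid k c → Kid k (node (m ++ labels c) (kids c))
      kid-++ = kid k
        where
        kid : ∀ k {m c} → m ⊆ KF k → Kid k c → Kid k (node (m ++ labels c) (kids c))
        kid (suc k) {c = node l cs} f (w , v) = All.++⁺ (All.tabulate f) w , v

      -- Children move from `cs` to `done` one by one: each receives the pushed labels and is
      -- replaced by a saturated member of `K k` containing it. As `l` no longer changes, finished
      -- children stay finished.
      grow : ∀ {l} → All (_∈ F k) l → ∀ cs {done} → All (Kid k) cs → All (KidOK l) done →
             Red (Grown l cs done) (node l (cs ++ done))
      grow w []       []        o = ret (_ , refl , o , (λ ()) , (λ i → i))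
      grow {l} w (node m ds ∷ cs) {done} (v ∷ vs) o =
        pushes (concatMap push l) id (bind
          (kid-Red {Q = λ t → ∃ λ c' → t ≡ node l (c' ∷ cs ++ done) × KidOK l c' × node m ds ↪ c'}
            (λ { (i , s , e) → _ , refl ,
                 (i , s , λ j → sim-labels e (∈-++⁺ˡ j) tt) ,
                 sim-trans (sim-⊆ (∈-++⁺ʳ (concatMap push l)) id) e })
            (sat-kids (kid-++ push-KF v)))
          λ { (c' , refl , o' , e) → weaken-Red (sim-⊆ id (rotate cs)) (map-Red
            (λ { (ds' , eq , os , f , g) → ds' , eq , os ,
                 (λ { (here refl) → c' , g (here refl) , e ; (there i) → f i }) , g ∘ there })
            (grow w cs vs (o' ∷ o))) })
        where
        push-KF : concatMap push l ⊆ KF k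
        push-KF i = let X , j , h = find (∈-concatMap⁻ push {xs = l} i)
                        p , d = push-parts X h
                    in F-modal k (All.lookup w j) p d
        rotate : ∀ {c'} cs → (cs ++ c' ∷ done) ⊆ (c' ∷ cs ++ done)
        rotate cs i with ∈-++⁻ cs i
        ... | inj₁ j           = there (∈-++⁺ˡ j)
        ... | inj₂ (here e)    = here e
        ... | inj₂ (there j)   = there (∈-++⁺ʳ cs j)

      saturate-node : ∀ {t} → WF k t → Red (SatExt (_∈ E k) t) t
      saturate-node {node l₀ cs} (w₀ , v) = bind (resolve w₀) afterResolve
        where
        afterResolve : ∀ {u} → Resolved (λ _ → ⊥) l₀ cs u → Red (SatExt (_∈ E k) (node l₀ cs)) u
        afterResolve (l , refl , f , w , d) with clash? l
        ... | inj₁ (p , i , j) = branch (⇐-clash i j) []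
        -- Spawning precedes `grow`, so that the new children receive the pushed labels too.
        ... | inj₂ nc = spawns sp id (weaken-Red
                (sim-⊆ id (λ i → [ id , (λ ()) ]′ (∈-++⁻ (map seedling sp ++ cs) i)))
                (bind (grow w (map seedling sp ++ cs) (All.++⁺ (All.map⁺ (All.tabulate spawn-Kid)) v) [])
                  finish))
          where
          sp = concatMap spawn l
          spawn-Kid : ∀ {Y} → Y ∈ sp → Kid k (seedling Y)
          spawn-Kid {Y} i = let X , j , h = find (∈-concatMap⁻ spawn {xs = l} i)
                                p , e = spawn-parts X h
                            in kid k (F-modal k (All.lookup w j) p e)
            where
            kid : ∀ k → Y ∈ KF k → Kid k (seedling Y)
            kid (suc k) i = i ∷ [] , []
          finish : ∀ {u} → Grown l (map seedling sp ++ cs) [] u → Red (SatExt (_∈ E k) (node l₀ cs)) u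
          finish (ds , refl , os , g , _) =
            -- The node is exchanged for a listed representative with the same sets of labels and
            -- children, which preserves saturation.
            let l' , li , a , b   = pow-complete (F k) l (All.lookup w)
                ds' , di , a' , b' = pow-complete (K k) ds (λ i → proj₁ (All.lookup os i))
            in weaken-Red (sim-⊆ a a') (ret
              ( ∈-cartesianProductWith⁺ node li di
              , sat (λ i → [ Any.map (All.map b) , ⊥-elim ]′ (d (a i)))
                    (λ i j → nc (a i) (a j))
                    (λ i → proj₂ (proj₂ (All.lookup os (a' i))) ∘ concatMap⁺ push a)
                    (λ i → let c , j , e = g (∈-++⁺ˡ (∈-map⁺ seedling (concatMap⁺ spawn a i)))
                           in c , b' j , sim-labels e (here refl) tt)
                    (λ i → proj₁ (proj₂ (All.lookup os (a' i))))
              , mk-sim (λ i _ → b (f i))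
                       (λ i → let c , j , e = g (∈-++⁺ʳ (map seedling sp) i) in c , b' j , e)))

  mutual
    saturate : ∀ k {t} → WF k t → Red (SatExt k (_∈ E k) t) t
    saturate k = saturate-node k (saturate-kid k)

    saturate-kid : ∀ k {t} → Kid k t → Red (SatExt k (_∈ K k) t) t
    saturate-kid (suc k) w = saturate k w

  -- Closure of bounded trees under grafting.

  mutual
    °-Kid : ∀ k {t} → Kid k t → Kid k (t °)
    °-Kid (suc k) {node l cs} (w , v) = All.filter⁺ isL? w , °s-Kid k v

    °s-Kid : ∀ k {cs} → All (Kid k) cs → All (Kid k) (cs °s)
    °s-Kid k []       = []
    °s-Kid k (v ∷ vs) = °-Kid k v ∷ °s-Kid k vs

  merge-WF : ∀ {k t y} → WF k t → WF k y → WF k (merge t y)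
  merge-WF {k} {node l cs} {node m ds} (w , v) (w' , v') =
    All.++⁺ w' (All.filter⁺ isL? w) , All.++⁺ v' (°s-Kid k v)

  -- `k` is the degree left at the end of `p`; a tree planted there has to respect it.
  graft-WF : ∀ {n T t} → WF n T → (p : Path T t) → ∃ λ k → WF k t × (∀ {y} → WF k y → WF n (graft p y))
  graft-WF w []      = _ , w , merge-WF w
  graft-WF w (_▹_ {t = node l cs} p i) with graft-WF w p
  ... | zero  , (_ , v) , f = ⊥-elim (All.lookup v i)
  ... | suc k , (_ , v) , f = k , All.lookup v i , λ w' → f ([] , merge-WF (All.lookup v i) w' ∷ [])

  seeds-WF : ∀ {k} X {y} → X ∈ F k → y ∈ seeds X → WF k y
  seeds-WF {k} (R (A ⊃ B)) i (here refl) with ∈F⁻ i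
  ... | j , d = ∈F⁺ (L A) (sub-parts A₀ j (here refl)) (ℕ.≤-trans (ℕ.m≤m⊔n _ _) d) ∷
                ∈F⁺ (R B) (sub-parts A₀ j (there (here refl))) (ℕ.≤-trans (ℕ.m≤n⊔m (deg A) _) d) ∷ [] , []
  -- A box has positive degree and cannot occur at level 0, where its seed would need a child.
  seeds-WF {zero}  (R (□ A)) i (here refl) with () ← F-modal zero {Y = R A} i (here refl) refl
  seeds-WF {suc k} (R (□ A)) i (here refl) =
    [] , (F-modal (suc k) {Y = R A} i (here refl) refl ∷ [] , []) ∷ []

  WF-labels : ∀ {k t X} → WF k t → X ∈ labels t → X ∈ F k
  WF-labels {t = node l cs} (w , _) = All.lookup w

  -- Discarding provable trees.

  module _ (n : ℕ) where

    record Elimination (alive : List Tree) : Set where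
      field
        alive⊆ : alive ⊆ E n
        dead   : ∀ {T} → T ∈ E n → T ∈ alive ⊎ SP T
    open Elimination

    -- The members of a saturated cover lie in `E n`, so each is alive or already provable.
    probe : ∀ {alive} → Elimination alive → ∀ {T} → WF n T →
            SP T ⊎ ∃ λ T' → T' ∈ alive × Sat T' × T ↪ T'
    probe el w = run (saturate n w) λ { (i , s , e) →
      [ (λ j → inj₂ (_ , j , s , e)) , (λ sp → inj₁ sp) ]′ (dead el i) }

    test : ∀ {alive} → Elimination alive → ∀ {T} → T ∈ alive → Good alive T ⊎ SP T
    test {alive} el {T} m = paths-or T (GoodAt alive) λ {t} p →
      all-or (labels t) λ {X} i → all-or (seeds X) λ {y} j → try p X i j
      where
      w = E-WF n (alive⊆ el m)
      try : ∀ {t} (p : Path T t) X {y} → X ∈ labels t → y ∈ seeds X → Witness alive p y ⊎ SP T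
      try p X i j with graft-WF w p
      -- If the graft is provable, `graft-SP` makes `T` provable; otherwise a live tree containing
      -- the graft holds the witness.
      ... | k , wt , f with probe el (f (seeds-WF X (WF-labels wt i) j))
      ... | inj₁ sp = inj₂ (graft-SP p (seed-SPat X i j) sp)
      ... | inj₂ (T' , m' , s , e) =
        let t' , p' , le , e' = graft-↪⁻ p e in inj₁ (witness m' s p' le e')

    -- A removal may destroy witnesses of other trees, so all are retested; the length of `alive`
    -- bounds the rounds.
    eliminate : ∀ k {alive} → length alive ≡ k → Elimination alive →
                ∃ λ alive' → Elimination alive' × (∀ {T} → T ∈ alive' → Good alive' T)
    eliminate k {alive} e el with all-or {C = ∃ λ T → T ∈ alive × SP T} alive
                                    (λ m → map₂ (λ sp → _ , m , sp) (test el m))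
    ... | inj₁ g = alive , el , g
    eliminate zero {[]} e el | inj₂ (_ , () , _)
    eliminate (suc k) {alive} e el | inj₂ (T , m , sp) =
      eliminate k (ℕ.suc-injective (≡-trans (sym (length-remove alive m)) e))
        record { alive⊆ = alive⊆ el ∘ remove-⊆ alive m
               ; dead   = λ i → [ (λ j → [ (λ { refl → inj₂ sp }) , inj₁ ]′ (∈-remove alive m j))
                              , inj₂ ]′ (dead el i) }

theorem4 : ∀ (A : Fm) → Valid A → Prov ([] ⇒ [ fm A ])
-- `deg A` is the least bound admitting `R A` as a label; at the start every listed tree is alive.
theorem4 A valid with Search.eliminate A (deg A) _ refl record { alive⊆ = id ; dead = inj₁ }
... | alive , el , good
  -- The one-node tree labelled `R A` embeds in the goal; if it is not provable, the root of a live
  -- saturated tree containing it refutes `A`.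
  with Search.probe A (deg A) el (Search.∈F⁺ A (R A) (here refl) ℕ.≤-refl ∷ [] , [])
... | inj₁ sp = sp hole _ (mk-emb (λ { (here refl) → here refl }) λ ())
... | inj₂ (T , m , s , e) =
  ⊥-elim (refuted A w (sim-labels e (here refl) tt) (valid model w))
  where
  open Countermodel alive good
  w = world m s []
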